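{- For every $\Gamma\cup\{\varphi\}\subseteq{\bf F}(\Sigma,\mathcal{V})$: $\Gamma\vdash_{C_1}\varphi$ iff $\Gamma\vDash^{\mathsf{RN}}_{\mathcal{RM}_{C_1}}\varphi$.
   Context: $\Sigma$ has unary $\neg$ and binary $\wedge,\vee,\to$; ${\bf F}(\Sigma,\mathcal{V})$ its formulas over a denumerable set $\mathcal{V}$ of variables. Abbreviations: $\alpha^0=\alpha$, $\alpha^{k+1}=\neg(\alpha^k\wedge\neg\alpha^k)$; $\alpha^{(1)}=\alpha^1$, $\alpha^{(k+1)}=\alpha^{(k)}\wedge\alpha^{k+1}$. For $n\ge1$, $C_n$ is the Hilbert calculus with Modus Ponens and axiom schemata: $\alpha\to(\beta\to\alpha)$; $(\alpha\to(\beta\to\gamma))\to((\alpha\to\beta)\to(\alpha\to\gamma))$; $\alpha\to(\beta\to(\alpha\wedge\beta))$; $(\alpha\wedge\beta)\to\alpha$; $(\alpha\wedge\beta)\to\beta$; $\alpha\to(\alpha\vee\beta)$; $\beta\to(\alpha\vee\beta)$; $(\alpha\to\gamma)\to((\beta\to\gamma)\to((\alpha\vee\beta)\to\gamma))$; $\alpha\vee\neg\alpha$; $\neg\neg\alpha\to\alpha$; (bc$_n$) $\alpha^{(n)}\to(\alpha\to(\neg\alpha\to\beta))$; (P$_n$) $(\alpha^{(n)}\wedge\beta^{(n)})\to((\alpha\wedge\beta)^{(n)}\wedge(\alpha\vee\beta)^{(n)}\wedge(\alpha\to\beta)^{(n)})$. $\mathcal{A}_{C_1}$ is the $\Sigma$-multialgebra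 with universe $\{F,t,T\}$, $D=\{t,T\}$, and: $F\tilde\vee F=\{F\}$, $F\tilde\vee T=T\tilde\vee F=T\tilde\vee T=\{T\}$, $x\tilde\vee y=D$ whenever $t\in\{x,y\}$; $x\tilde\wedge y=\{F\}$ if $F\in\{x,y\}$, $T\tilde\wedge T=\{T\}$, $t\tilde\wedge t=t\tilde\wedge T=T\tilde\wedge t=D$; $\tilde\neg F=\{T\}$, $\tilde\neg t=D$, $\tilde\neg T=\{F\}$; $F\tilde\to F=F\tilde\to T=T\tilde\to T=\{T\}$, $t\tilde\to F=T\tilde\to F=\{F\}$, $x\tilde\to t=D$ for all $x$, $t\tilde\to T=D$. A valuation is a map $\nu$ with $\nu(\neg\alpha)\in\tilde\neg\nu(\alpha)$ and $\nu(\alpha\#\beta)\in\nu(\alpha)\tilde\#\nu(\beta)$. $\mathcal{F}_{C_1}$ is the set of valuations with $\nu(\alpha)=t\Rightarrow\nu(\alpha\wedge\neg\alpha)=T$ for all $\alpha$. $\mathcal{RM}_{C_1}=(\mathcal{A}_{C_1},D,\mathcal{F}_{C_1})$; $\Gamma\vDash^{\mathsf{RN}}_{\mathcal{RM}_{C_1}}\varphi$ iff every $\nu\in\mathcal{F}_{C_1}$ with $\nu[\Gamma]\subseteq D$ has $\nu(\varphi)\in D$. -}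

module Defs where

open import Data.Nat using (ℕ; zero; suc; NonZero)
open import Data.Product using (_×_; _,_; proj₁)
open import Data.Sum using (inj₁)
open import Level using (Level; 0ℓ)
open import Relation.Binary.PropositionalEquality using (_≡_; refl)
open import Relation.Unary using (Pred; _∈_; _∪_; ｛_｝; Satisfiable)

private
  variable
    ℓ : Level

infix  9 ~_
infixl 8 _∧_
infixl 7 _∨_
infixr 6 _⇒_
infixl 10 _^_ _^⟨_⟩

-- The denumerable set of variables is ℕ.
data Formula : Set where
  var         : ℕ → Formula
  ~_          : Formula → Formula
  _∧_ _∨_ _⇒_ : Formula → Formula → Formula

_^_ : Formula → ℕ → Formula
α ^ zero  = α
α ^ suc k = ~ (α ^ k ∧ ~ (α ^ k))

-- α ^⟨ n ⟩ is α⁽ⁿ⁾ = α¹ ∧ … ∧ αⁿ, associated to the left and defined for n ≥ 1 only.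
_^⟨_⟩ : Formula → (n : ℕ) .{{_ : NonZero n}} → Formula
α ^⟨ suc zero ⟩    = α ^ 1
α ^⟨ suc (suc k) ⟩ = α ^⟨ suc k ⟩ ∧ α ^ suc (suc k)

data Axiom (n : ℕ) .{{_ : NonZero n}} : Pred Formula 0ℓ where
  K     : ∀ α β → Axiom n (α ⇒ (β ⇒ α))
  S     : ∀ α β γ → Axiom n ((α ⇒ (β ⇒ γ)) ⇒ ((α ⇒ β) ⇒ (α ⇒ γ)))
  ∧-I   : ∀ α β → Axiom n (α ⇒ (β ⇒ (α ∧ β)))
  ∧-E₁  : ∀ α β → Axiom n ((α ∧ β) ⇒ α)
  ∧-E₂  : ∀ α β → Axiom n ((α ∧ β) ⇒ β)
  ∨-I₁  : ∀ α β → Axiom n (α ⇒ (α ∨ β))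
  ∨-I₂  : ∀ α β → Axiom n (β ⇒ (α ∨ β))
  ∨-E   : ∀ α β γ → Axiom n ((α ⇒ γ) ⇒ ((β ⇒ γ) ⇒ ((α ∨ β) ⇒ γ)))
  tnd   : ∀ α → Axiom n (α ∨ ~ α)
  dne   : ∀ α → Axiom n (~ ~ α ⇒ α)
  bc    : ∀ α β → Axiom n (α ^⟨ n ⟩ ⇒ (α ⇒ (~ α ⇒ β)))
  P     : ∀ α β → Axiom n ((α ^⟨ n ⟩ ∧ β ^⟨ n ⟩) ⇒
            (((α ∧ β) ^⟨ n ⟩ ∧ (α ∨ β) ^⟨ n ⟩) ∧ (α ⇒ β) ^⟨ n ⟩))

infix 4 _⊢C[_]_

-- Γ ⊢C[ n ] φ : derivability of φ from Γ in the Hilbert calculus Cₙ.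
data _⊢C[_]_ (Γ : Pred Formula ℓ) (n : ℕ) .{{_ : NonZero n}} : Formula → Set ℓ where
  hyp : ∀ {α} → α ∈ Γ → Γ ⊢C[ n ] α
  ax  : ∀ {α} → Axiom n α → Γ ⊢C[ n ] α
  mp  : ∀ {α β} → Γ ⊢C[ n ] (α ⇒ β) → Γ ⊢C[ n ] α → Γ ⊢C[ n ] β

record Multialgebra : Set₁ where
  field
    Carrier        : Set
    neg            : Carrier → Pred Carrier 0ℓ
    and or imp     : Carrier → Carrier → Pred Carrier 0ℓ
    neg-nonempty   : ∀ x → Satisfiable (neg x)
    and-nonempty   : ∀ x y → Satisfiable (and x y)
    or-nonempty    : ∀ x y → Satisfiable (or x y)
    imp-nonempty   : ∀ x y → Satisfiable (imp x y)

record IsValuation (A : Multialgebra) (ν : Formula → Multialgebra.Carrier A) : Set where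
  open Multialgebra A
  field
    neg-ok : ∀ α → ν (~ α) ∈ neg (ν α)
    and-ok : ∀ α β → ν (α ∧ β) ∈ and (ν α) (ν β)
    or-ok  : ∀ α β → ν (α ∨ β) ∈ or (ν α) (ν β)
    imp-ok : ∀ α β → ν (α ⇒ β) ∈ imp (ν α) (ν β)

-- Restricted non-deterministic matrices: only the valuations in 𝓕 count.
record RNmatrix : Set₁ where
  field
    algebra       : Multialgebra
  open Multialgebra algebra public
  field
    Designated    : Pred Carrier 0ℓ
    𝓕             : Pred (Formula → Carrier) 0ℓ
    𝓕⇒valuation   : ∀ {ν} → ν ∈ 𝓕 → IsValuation algebra ν

infix 4 _⊨[_]_

_⊨[_]_ : Pred Formula ℓ → RNmatrix → Formula → Set ℓ
Γ ⊨[ M ] φ = ∀ ν → ν ∈ 𝓕 → (∀ {γ} → γ ∈ Γ → ν γ ∈ Designated) → ν φ ∈ Designated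
  where open RNmatrix M

data Three : Set where
  F t T : Three

D : Pred Three 0ℓ
D = ｛ t ｝ ∪ ｛ T ｝

neg₁ : Three → Pred Three 0ℓ
neg₁ F = ｛ T ｝
neg₁ t = D
neg₁ T = ｛ F ｝

and₁ or₁ imp₁ : Three → Three → Pred Three 0ℓ

and₁ F F = ｛ F ｝
and₁ F t = ｛ F ｝
and₁ F T = ｛ F ｝
and₁ t F = ｛ F ｝
and₁ t t = D
and₁ t T = D
and₁ T F = ｛ F ｝
and₁ T t = D
and₁ T T = ｛ T ｝

or₁ F F = ｛ F ｝
or₁ F t = D
or₁ F T = ｛ T ｝
or₁ t F = D
or₁ t t = D
or₁ t T = D
or₁ T F = ｛ T ｝
or₁ T t = D
or₁ T T = ｛ T ｝

imp₁ F F = ｛ T ｝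
imp₁ F t = D
imp₁ F T = ｛ T ｝
imp₁ t F = ｛ F ｝
imp₁ t t = D
imp₁ t T = D
imp₁ T F = ｛ F ｝
imp₁ T t = D
imp₁ T T = ｛ T ｝

private
  D-nonempty : Satisfiable D
  D-nonempty = t , inj₁ refl

  neg₁-nonempty : ∀ x → Satisfiable (neg₁ x)
  neg₁-nonempty F = T , refl
  neg₁-nonempty t = D-nonempty
  neg₁-nonempty T = F , refl

  and₁-nonempty : ∀ x y → Satisfiable (and₁ x y)
  and₁-nonempty F F = F , refl
  and₁-nonempty F t = F , refl
  and₁-nonempty F T = F , refl
  and₁-nonempty t F = F , refl
  and₁-nonempty t t = D-nonempty
  and₁-nonempty t T = D-nonempty
  and₁-nonempty T F = F , refl
  and₁-nonempty T t = D-nonempty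
  and₁-nonempty T T = T , refl

  or₁-nonempty : ∀ x y → Satisfiable (or₁ x y)
  or₁-nonempty F F = F , refl
  or₁-nonempty F t = D-nonempty
  or₁-nonempty F T = T , refl
  or₁-nonempty t F = D-nonempty
  or₁-nonempty t t = D-nonempty
  or₁-nonempty t T = D-nonempty
  or₁-nonempty T F = T , refl
  or₁-nonempty T t = D-nonempty
  or₁-nonempty T T = T , refl

  imp₁-nonempty : ∀ x y → Satisfiable (imp₁ x y)
  imp₁-nonempty F F = T , refl
  imp₁-nonempty F t = D-nonempty
  imp₁-nonempty F T = T , refl
  imp₁-nonempty t F = F , refl
  imp₁-nonempty t t = D-nonempty
  imp₁-nonempty t T = D-nonempty
  imp₁-nonempty T F = F , refl
  imp₁-nonempty T t = D-nonempty
  imp₁-nonempty T T = T , refl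

A-C₁ : Multialgebra
A-C₁ = record
  { Carrier      = Three
  ; neg          = neg₁
  ; and          = and₁
  ; or           = or₁
  ; imp          = imp₁
  ; neg-nonempty = neg₁-nonempty
  ; and-nonempty = and₁-nonempty
  ; or-nonempty  = or₁-nonempty
  ; imp-nonempty = imp₁-nonempty
  }

F-C₁ : Pred (Formula → Three) 0ℓ
F-C₁ ν = IsValuation A-C₁ ν × (∀ α → ν α ≡ t → ν (α ∧ ~ α) ≡ T)

RM-C₁ : RNmatrix
RM-C₁ = record
  { algebra     = A-C₁
  ; Designated  = D
  ; 𝓕           = F-C₁
  ; 𝓕⇒valuation = proj₁
  }

{-# OPTIONS --safe #-}
module Submission where

-- Soundness: for ν in 𝓕, designation is classical on ∧, ∨, ⇒, and ν(α¹) is designated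
-- exactly when ν(α) ≠ t; hence (bc₁) holds, and (P₁) says that {F, T} is closed under the
-- binary operations.
-- Completeness: if Γ ⊬ φ, extend Γ to a set Δ maximal among those not proving φ, and let
-- ν(α) be F if α ∉ Δ, t if α, ¬α ∈ Δ, and T if α ∈ Δ, ¬α ∉ Δ. Then ν(α) ≠ t iff α¹ ∈ Δ,
-- so (P₁) and (bc₁) for Δ make ν a valuation in 𝓕 which refutes φ.

open import Defs
open import Axiom.ExcludedMiddle using (ExcludedMiddle)
open import Data.List using (List; []; _∷_; _++_; map; foldl; cartesianProductWith)
open import Data.List.Membership.Propositional using () renaming (_∈_ to _∈ₗ_)
open import Data.List.Membership.Propositional.Properties using (∈-++⁺ˡ; ∈-++⁺ʳ; ∈-map⁺; ∈-cartesianProductWith⁺)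
open import Data.List.Relation.Unary.Any using (here; there)
open import Data.Nat using (ℕ; zero; suc; NonZero; nonZero; _⊔_; _≤′_; ≤′-refl; ≤′-step)
open import Data.Nat.Properties using (≤⇒≤′; m≤m⊔n; m≤n⊔m)
open import Data.Product using (_×_; _,_; proj₁; proj₂; ∃-syntax)
open import Data.Sum using (_⊎_; inj₁; inj₂; [_,_]′)
open import Function.Base using (_∘_; id)
open import Function.Bundles using (_⇔_; mk⇔)
open import Level using (Level)
open import Relation.Binary.PropositionalEquality using (_≡_; _≢_; refl; sym; subst)
open import Relation.Nullary using (¬_; Dec; yes; no; contradiction)
open import Relation.Nullary.Decidable using (decidable-stable)
open import Relation.Unary using (Pred; _∈_; _∉_; _⊆_; _∪_; ｛_｝)

private
  variable
    ℓ ℓ′ : Level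
    z : Three
    α β φ : Formula

-- Designation in A-C₁

F∉D : F ∉ D
F∉D (inj₁ ())
F∉D (inj₂ ())

t∈D : t ∈ D
t∈D = inj₁ refl

T∈D : T ∈ D
T∈D = inj₂ refl

and-elim₁ : ∀ x y → z ∈ and₁ x y → z ∈ D → x ∈ D
and-elim₁ F F refl z∈D = z∈D
and-elim₁ F t refl z∈D = z∈D
and-elim₁ F T refl z∈D = z∈D
and-elim₁ t y _ _ = t∈D
and-elim₁ T y _ _ = T∈D

and-elim₂ : ∀ x y → z ∈ and₁ x y → z ∈ D → y ∈ D
and-elim₂ F F refl z∈D = z∈D
and-elim₂ t F refl z∈D = z∈D
and-elim₂ T F refl z∈D = z∈D
and-elim₂ x t _ _ = t∈D
and-elim₂ x T _ _ = T∈D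

and-intro : ∀ x y → z ∈ and₁ x y → x ∈ D → y ∈ D → z ∈ D
and-intro F y z∈ F∈D _ = contradiction F∈D F∉D
and-intro t F z∈ _ F∈D = contradiction F∈D F∉D
and-intro T F z∈ _ F∈D = contradiction F∈D F∉D
and-intro t t z∈ _ _ = z∈
and-intro t T z∈ _ _ = z∈
and-intro T t z∈ _ _ = z∈
and-intro T T z∈ _ _ = inj₂ z∈

or-intro₁ : ∀ x y → z ∈ or₁ x y → x ∈ D → z ∈ D
or-intro₁ F y z∈ F∈D = contradiction F∈D F∉D
or-intro₁ t F z∈ _ = z∈
or-intro₁ t t z∈ _ = z∈
or-intro₁ t T z∈ _ = z∈
or-intro₁ T F z∈ _ = inj₂ z∈
or-intro₁ T t z∈ _ = z∈
or-intro₁ T T z∈ _ = inj₂ z∈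

or-intro₂ : ∀ x y → z ∈ or₁ x y → y ∈ D → z ∈ D
or-intro₂ x F z∈ F∈D = contradiction F∈D F∉D
or-intro₂ F t z∈ _ = z∈
or-intro₂ t t z∈ _ = z∈
or-intro₂ T t z∈ _ = z∈
or-intro₂ F T z∈ _ = inj₂ z∈
or-intro₂ t T z∈ _ = z∈
or-intro₂ T T z∈ _ = inj₂ z∈

or-elim : ∀ x y → z ∈ or₁ x y → z ∈ D → x ∈ D ⊎ y ∈ D
or-elim F F refl z∈D = inj₁ z∈D
or-elim F t _ _ = inj₂ t∈D
or-elim F T _ _ = inj₂ T∈D
or-elim t y _ _ = inj₁ t∈D
or-elim T y _ _ = inj₁ T∈D

imp-elim : ∀ x y → z ∈ imp₁ x y → z ∈ D → x ∈ D → y ∈ D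
imp-elim F F _ _ x∈D = x∈D
imp-elim t F refl z∈D _ = z∈D
imp-elim T F refl z∈D _ = z∈D
imp-elim x t _ _ _ = t∈D
imp-elim x T _ _ _ = T∈D

imp-intro : ∀ x y → z ∈ imp₁ x y → (x ∈ D → y ∈ D) → z ∈ D
imp-intro F F z∈ _ = inj₂ z∈
imp-intro F t z∈ _ = z∈
imp-intro F T z∈ _ = inj₂ z∈
imp-intro t F refl f = f t∈D
imp-intro t t z∈ _ = z∈
imp-intro t T z∈ _ = z∈
imp-intro T F refl f = f T∈D
imp-intro T t z∈ _ = z∈
imp-intro T T z∈ _ = inj₂ z∈

-- On `F` and `T` the operation is single-valued and Boolean. This and its two analogues below are
-- the semantic content of (P₁).
and-≢t : ∀ x y → z ∈ and₁ x y → x ≢ t → y ≢ t → z ≢ t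
and-≢t t y _ x≢t _ _ = x≢t refl
and-≢t x t _ _ y≢t _ = y≢t refl
and-≢t F F refl _ _ ()
and-≢t F T refl _ _ ()
and-≢t T F refl _ _ ()
and-≢t T T refl _ _ ()

or-≢t : ∀ x y → z ∈ or₁ x y → x ≢ t → y ≢ t → z ≢ t
or-≢t t y _ x≢t _ _ = x≢t refl
or-≢t x t _ _ y≢t _ = y≢t refl
or-≢t F F refl _ _ ()
or-≢t F T refl _ _ ()
or-≢t T F refl _ _ ()
or-≢t T T refl _ _ ()

imp-≢t : ∀ x y → z ∈ imp₁ x y → x ≢ t → y ≢ t → z ≢ t
imp-≢t t y _ x≢t _ _ = x≢t refl
imp-≢t x t _ _ y≢t _ = y≢t refl
imp-≢t F F refl _ _ ()
imp-≢t F T refl _ _ ()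
imp-≢t T F refl _ _ ()
imp-≢t T T refl _ _ ()

-- Soundness

module _ {ν : Formula → Three} (ν∈𝓕 : ν ∈ F-C₁) where
  open IsValuation (proj₁ ν∈𝓕)

  private
    ⇒⁺ : (ν α ∈ D → ν β ∈ D) → ν (α ⇒ β) ∈ D
    ⇒⁺ = imp-intro _ _ (imp-ok _ _)

    ⇒⁻ : ν (α ⇒ β) ∈ D → ν α ∈ D → ν β ∈ D
    ⇒⁻ = imp-elim _ _ (imp-ok _ _)

    ∧⁺ : ν α ∈ D → ν β ∈ D → ν (α ∧ β) ∈ D
    ∧⁺ = and-intro _ _ (and-ok _ _)

    ∧⁻₁ : ν (α ∧ β) ∈ D → ν α ∈ D
    ∧⁻₁ = and-elim₁ _ _ (and-ok _ _)

    ∧⁻₂ : ν (α ∧ β) ∈ D → ν β ∈ D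
    ∧⁻₂ = and-elim₂ (ν _) _ (and-ok _ _)

    ∨⁺₁ : ν α ∈ D → ν (α ∨ β) ∈ D
    ∨⁺₁ = or-intro₁ _ _ (or-ok _ _)

    ∨⁺₂ : ν β ∈ D → ν (α ∨ β) ∈ D
    ∨⁺₂ = or-intro₂ (ν _) _ (or-ok _ _)

    ∨⁻ : ν (α ∨ β) ∈ D → ν α ∈ D ⊎ ν β ∈ D
    ∨⁻ = or-elim _ _ (or-ok _ _)

  α∨~α-designated : ∀ α → ν α ∈ D ⊎ ν (~ α) ∈ D
  α∨~α-designated α with ν α | neg-ok α
  ... | F | eq = inj₂ (inj₂ eq)
  ... | t | _  = inj₁ t∈D
  ... | T | _  = inj₁ T∈D

  ~~-designated : ∀ α → ν (~ ~ α) ∈ D → ν α ∈ D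
  ~~-designated α ~~α∈D with ν α | neg-ok α
  ... | t | _  = t∈D
  ... | T | _  = T∈D
  -- `ν α` = `F` forces `ν (~ α)` = `T`, hence `ν (~ ~ α)` = `F`, and the hypothesis becomes the
  -- absurd goal `F ∈ D`.
  ... | F | T≡ν~α = subst D (sym (subst (λ x → ν (~ ~ α) ∈ neg₁ x) (sym T≡ν~α) (neg-ok (~ α)))) ~~α∈D

  -- `T` is negated to `F` only, so `t` is the one designated value compatible with a designated
  -- negation.
  α,~α-designated⇒t : ∀ α → ν α ∈ D → ν (~ α) ∈ D → ν α ≡ t
  α,~α-designated⇒t α α∈D ~α∈D with ν α | neg-ok α
  ... | F | _  = contradiction α∈D F∉D
  ... | t | _  = refl
  ... | T | eq = contradiction (subst D (sym eq) ~α∈D) F∉D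

  -- `α ^ 1` is `~ (α ∧ ~ α)`: if it is not designated, `α ∧ ~ α` is, which forces `t` on `α`.
  ≢t⇒¹-designated : ∀ α → ν α ≢ t → ν (α ^ 1) ∈ D
  ≢t⇒¹-designated α α≢t with α∨~α-designated (α ∧ ~ α)
  ... | inj₁ p = contradiction (α,~α-designated⇒t α (∧⁻₁ p) (∧⁻₂ p)) α≢t
  ... | inj₂ p = p

  -- The restriction defining `F-C₁` enters soundness here: it fixes `α ∧ ~ α` at `T`, whose
  -- negation is `F`. The tables alone would also allow `t`, whose negation is designated.
  ¹-designated⇒≢t : ∀ α → ν (α ^ 1) ∈ D → ν α ≢ t
  ¹-designated⇒≢t α p α≡t
    with ν (α ∧ ~ α) | proj₂ ν∈𝓕 α α≡t | neg-ok (α ∧ ~ α)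
  ... | .T | refl | eq = F∉D (subst D (sym eq) p)

  axiom-designated : Axiom 1 α → ν α ∈ D
  axiom-designated (K α β) = ⇒⁺ λ a → ⇒⁺ λ _ → a
  axiom-designated (S α β γ) = ⇒⁺ λ f → ⇒⁺ λ g → ⇒⁺ λ a → ⇒⁻ (⇒⁻ f a) (⇒⁻ g a)
  axiom-designated (∧-I α β) = ⇒⁺ λ a → ⇒⁺ λ b → ∧⁺ a b
  axiom-designated (∧-E₁ α β) = ⇒⁺ ∧⁻₁
  axiom-designated (∧-E₂ α β) = ⇒⁺ ∧⁻₂
  axiom-designated (∨-I₁ α β) = ⇒⁺ ∨⁺₁
  axiom-designated (∨-I₂ α β) = ⇒⁺ ∨⁺₂
  axiom-designated (∨-E α β γ) = ⇒⁺ λ f → ⇒⁺ λ g → ⇒⁺ λ c → [ ⇒⁻ f , ⇒⁻ g ]′ (∨⁻ c)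
  axiom-designated (tnd α) = [ ∨⁺₁ , ∨⁺₂ ]′ (α∨~α-designated α)
  axiom-designated (dne α) = ⇒⁺ (~~-designated α)
  axiom-designated (bc α β) = ⇒⁺ λ α¹ → ⇒⁺ λ a → ⇒⁺ λ ~a →
    contradiction (α,~α-designated⇒t α a ~a) (¹-designated⇒≢t α α¹)
  axiom-designated (P α β) = ⇒⁺ λ c →
    let α≢t = ¹-designated⇒≢t α (∧⁻₁ c)
        β≢t = ¹-designated⇒≢t β (∧⁻₂ c)
    in ∧⁺ (∧⁺ (≢t⇒¹-designated (α ∧ β) (and-≢t _ _ (and-ok α β) α≢t β≢t))
              (≢t⇒¹-designated (α ∨ β) (or-≢t _ _ (or-ok α β) α≢t β≢t)))
          (≢t⇒¹-designated (α ⇒ β) (imp-≢t _ _ (imp-ok α β) α≢t β≢t))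

  ⊢-designated : {Γ : Pred Formula ℓ} → (∀ {γ} → γ ∈ Γ → ν γ ∈ D) → Γ ⊢C[ 1 ] φ → ν φ ∈ D
  ⊢-designated Γ⊆D (hyp γ∈Γ) = Γ⊆D γ∈Γ
  ⊢-designated Γ⊆D (ax a)    = axiom-designated a
  ⊢-designated Γ⊆D (mp d e)  = ⇒⁻ (⊢-designated Γ⊆D d) (⊢-designated Γ⊆D e)

sound : {Γ : Pred Formula ℓ} → Γ ⊢C[ 1 ] φ → Γ ⊨[ RM-C₁ ] φ
sound d ν ν∈𝓕 Γ⊆D = ⊢-designated ν∈𝓕 Γ⊆D d

-- The Lindenbaum construction

-- Finite cumulative lists replace a bijection with ℕ. Keeping `L` makes them increasing, so that
-- components found in different lists meet in a common one.
formulas : ℕ → List Formula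
formulas zero    = []
formulas (suc n) = var n ∷ L ++ map ~_ L
    ++ cartesianProductWith _∧_ L L ++ cartesianProductWith _∨_ L L ++ cartesianProductWith _⇒_ L L
  where L = formulas n

formulas-mono : ∀ {m n} → m ≤′ n → α ∈ₗ formulas m → α ∈ₗ formulas n
formulas-mono ≤′-refl        α∈ = α∈
formulas-mono (≤′-step m≤′n) α∈ = there (∈-++⁺ˡ (formulas-mono m≤′n α∈))

formulas-join : ∃[ m ] α ∈ₗ formulas m → ∃[ n ] β ∈ₗ formulas n →
  ∃[ k ] (α ∈ₗ formulas k × β ∈ₗ formulas k)
formulas-join (m , α∈) (n , β∈) =
  m ⊔ n , formulas-mono (≤⇒≤′ (m≤m⊔n m n)) α∈ , formulas-mono (≤⇒≤′ (m≤n⊔m m n)) β∈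

formulas-exhaustive : ∀ α → ∃[ n ] α ∈ₗ formulas n
formulas-exhaustive (var i) = suc i , here refl
formulas-exhaustive (~ α) with formulas-exhaustive α
... | n , α∈ = suc n , there (∈-++⁺ʳ L (∈-++⁺ˡ (∈-map⁺ ~_ α∈)))
  where L = formulas n
formulas-exhaustive (α ∧ β) with formulas-join (formulas-exhaustive α) (formulas-exhaustive β)
... | n , α∈ , β∈ = suc n , there (∈-++⁺ʳ L (∈-++⁺ʳ (map ~_ L)
    (∈-++⁺ˡ (∈-cartesianProductWith⁺ _∧_ α∈ β∈))))
  where L = formulas n
formulas-exhaustive (α ∨ β) with formulas-join (formulas-exhaustive α) (formulas-exhaustive β)
... | n , α∈ , β∈ = suc n , there (∈-++⁺ʳ L (∈-++⁺ʳ (map ~_ L)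
    (∈-++⁺ʳ (cartesianProductWith _∧_ L L) (∈-++⁺ˡ (∈-cartesianProductWith⁺ _∨_ α∈ β∈)))))
  where L = formulas n
formulas-exhaustive (α ⇒ β) with formulas-join (formulas-exhaustive α) (formulas-exhaustive β)
... | n , α∈ , β∈ = suc n , there (∈-++⁺ʳ L (∈-++⁺ʳ (map ~_ L)
    (∈-++⁺ʳ (cartesianProductWith _∧_ L L) (∈-++⁺ʳ (cartesianProductWith _∨_ L L)
      (∈-cartesianProductWith⁺ _⇒_ α∈ β∈)))))
  where L = formulas n

-- Weakening and the deduction theorem

module _ {n : ℕ} .{{_ : NonZero n}} where

  ⊢-weaken : {Γ : Pred Formula ℓ} {Δ : Pred Formula ℓ′} → Γ ⊆ Δ → Γ ⊢C[ n ] α → Δ ⊢C[ n ] α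
  ⊢-weaken Γ⊆Δ (hyp α∈Γ) = hyp (Γ⊆Δ α∈Γ)
  ⊢-weaken Γ⊆Δ (ax a)    = ax a
  ⊢-weaken Γ⊆Δ (mp d e)  = mp (⊢-weaken Γ⊆Δ d) (⊢-weaken Γ⊆Δ e)

  deduction : {Γ : Pred Formula ℓ} → Γ ∪ ｛ α ｝ ⊢C[ n ] β → Γ ⊢C[ n ] (α ⇒ β)
  deduction (hyp (inj₁ β∈Γ))  = mp (ax (K _ _)) (hyp β∈Γ)
  -- `α ⇒ α` is derived as S K K, with `α ⇒ α` itself as the middle formula of `S`.
  deduction {α = α} (hyp (inj₂ refl)) = mp (mp (ax (S _ (α ⇒ α) _)) (ax (K _ _))) (ax (K _ _))
  deduction (ax a)            = mp (ax (K _ _)) (ax a)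
  deduction (mp d e)          = mp (mp (ax (S _ _ _)) (deduction d)) (deduction e)

-- Extension to a set maximal for not proving `φ`

module Lindenbaum (n : ℕ) .{{_ : NonZero n}} (φ : Formula) where

  -- Maximality is relative to `φ`, not to consistency: a nontrivial set may contain both `α` and
  -- `~ α`.
  record IsMaximal (Δ : Pred Formula ℓ) : Set ℓ where
    field
      unprovable : ¬ (Δ ⊢C[ n ] φ)
      maximal    : ∀ {α} → α ∉ Δ → Δ ∪ ｛ α ｝ ⊢C[ n ] φ

  infixl 5 _◃_

  -- The proviso is carried by the membership proof instead of being decided, so the set is built
  -- without a case distinction.
  _◃_ : Pred Formula ℓ → Formula → Pred Formula ℓ
  (Γ ◃ α) β = β ∈ Γ ⊎ (α ≡ β × ¬ (Γ ∪ ｛ α ｝ ⊢C[ n ] φ))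

  -- A derivation of `φ` from `Γ ◃ α` is also one from `Γ ∪ ｛ α ｝`, which refutes the proviso for
  -- `α`. So nothing was added, and the derivation already works over `Γ`.
  ◃-unprovable : {Γ : Pred Formula ℓ} → ¬ (Γ ⊢C[ n ] φ) → ¬ (Γ ◃ α ⊢C[ n ] φ)
  ◃-unprovable {α = α} {Γ = Γ} Γ⊬φ d = Γ⊬φ (⊢-weaken ◃⊆Γ d)
    where
    Γ∪α⊢φ : Γ ∪ ｛ α ｝ ⊢C[ n ] φ
    Γ∪α⊢φ = ⊢-weaken [ inj₁ , inj₂ ∘ proj₁ ]′ d

    ◃⊆Γ : Γ ◃ α ⊆ Γ
    ◃⊆Γ = [ id , (λ p → contradiction Γ∪α⊢φ (proj₂ p)) ]′

  foldl-◃-⊇ : ∀ αs {Γ : Pred Formula ℓ} → Γ ⊆ foldl _◃_ Γ αs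
  foldl-◃-⊇ []       β∈Γ = β∈Γ
  foldl-◃-⊇ (α ∷ αs) β∈Γ = foldl-◃-⊇ αs (inj₁ β∈Γ)

  foldl-◃-unprovable : ∀ αs {Γ : Pred Formula ℓ} → ¬ (Γ ⊢C[ n ] φ) → ¬ (foldl _◃_ Γ αs ⊢C[ n ] φ)
  foldl-◃-unprovable []       Γ⊬φ = Γ⊬φ
  foldl-◃-unprovable (α ∷ αs) Γ⊬φ = foldl-◃-unprovable αs (◃-unprovable Γ⊬φ)

  -- At its turn `α` is refused only if it proves `φ` together with the set reached so far;
  -- weakening carries this to the end of the fold.
  foldl-◃-maximal : ExcludedMiddle ℓ → ∀ {αs} {Γ : Pred Formula ℓ} → α ∈ₗ αs →
    α ∉ foldl _◃_ Γ αs → foldl _◃_ Γ αs ∪ ｛ α ｝ ⊢C[ n ] φ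
  foldl-◃-maximal em {_ ∷ αs} (here refl) α∉ =
    ⊢-weaken [ inj₁ ∘ foldl-◃-⊇ αs ∘ inj₁ , inj₂ ]′
      (decidable-stable em λ ⊬φ → α∉ (foldl-◃-⊇ αs (inj₂ (refl , ⊬φ))))
  foldl-◃-maximal em (there α∈αs) α∉ = foldl-◃-maximal em α∈αs α∉

  module _ (Γ : Pred Formula ℓ) where

    stage : ℕ → Pred Formula ℓ
    stage zero    = Γ
    stage (suc k) = foldl _◃_ (stage k) (formulas k)

    limit : Pred Formula ℓ
    limit α = ∃[ k ] α ∈ stage k

    stage-mono : ∀ {j k} → j ≤′ k → stage j ⊆ stage k
    stage-mono ≤′-refl        α∈ = α∈
    stage-mono (≤′-step {k} j≤′k) α∈ = foldl-◃-⊇ (formulas k) (stage-mono j≤′k α∈)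

    stage-unprovable : ¬ (Γ ⊢C[ n ] φ) → ∀ k → ¬ (stage k ⊢C[ n ] φ)
    stage-unprovable Γ⊬φ zero    = Γ⊬φ
    stage-unprovable Γ⊬φ (suc k) = foldl-◃-unprovable (formulas k) (stage-unprovable Γ⊬φ k)

    -- Derivations are finite and the stages form a chain, so the later of two stages serves both
    -- premises of `mp`.
    limit-compact : limit ⊢C[ n ] α → ∃[ k ] (stage k ⊢C[ n ] α)
    limit-compact (hyp (k , α∈)) = k , hyp α∈
    limit-compact (ax a)         = 0 , ax a
    limit-compact (mp d e) with limit-compact d | limit-compact e
    ... | j , d′ | k , e′ = j ⊔ k , mp (⊢-weaken (stage-mono (≤⇒≤′ (m≤m⊔n j k))) d′)
                                       (⊢-weaken (stage-mono (≤⇒≤′ (m≤n⊔m j k))) e′)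

    limit-maximal : ExcludedMiddle ℓ → ¬ (Γ ⊢C[ n ] φ) → IsMaximal limit
    limit-maximal em Γ⊬φ = record
      { unprovable = λ d → let k , d′ = limit-compact d in stage-unprovable Γ⊬φ k d′
      ; maximal    = λ {α} α∉ →
          let k , α∈ = formulas-exhaustive α
          -- Formulas listed in `formulas k` are treated on the way from stage `k` to stage `suc k`.
          in ⊢-weaken [ inj₁ ∘ (suc k ,_) , inj₂ ]′
               (foldl-◃-maximal em α∈ λ α∈stage → α∉ (suc k , α∈stage))
      }

-- The canonical valuation

∉D⇒≡F : z ∉ D → F ≡ z
∉D⇒≡F {F} _   = refl
∉D⇒≡F {t} t∉D = contradiction t∈D t∉D
∉D⇒≡F {T} T∉D = contradiction T∈D T∉D

∈D∧≢t⇒≡T : z ∈ D → z ≢ t → T ≡ z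
∈D∧≢t⇒≡T (inj₁ refl) z≢t = contradiction refl z≢t
∈D∧≢t⇒≡T (inj₂ T≡z)  _   = T≡z

F≢t : F ≢ t
F≢t ()

T≢t : T ≢ t
T≢t ()

-- With `x` = `ν α` and `z` = `ν (~ α)`, the premises will come from excluded middle, double
-- negation elimination, and the two directions of the reading of `t` as "both `α` and `~ α` in
-- `Δ`".
∈neg₁ : ∀ x → (x ∉ D → z ∈ D) → (z ≡ t → x ∈ D) → (x ≡ t → z ∈ D) →
  (x ∈ D → z ∈ D → x ≡ t) → z ∈ neg₁ x
∈neg₁ F f g _ _ = ∈D∧≢t⇒≡T (f F∉D) (F∉D ∘ g)
∈neg₁ t _ _ h _ = h refl
∈neg₁ T _ _ _ k = ∉D⇒≡F (T≢t ∘ k T∈D)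

-- Classical behaviour of designation settles the entries `｛ F ｝` and `D`; the last premise,
-- supplied by (P₁), cuts `D` down to `｛ T ｝`. The same holds for `∈or₁` and `∈imp₁`.
∈and₁ : ∀ x y → (z ∈ D → x ∈ D) → (z ∈ D → y ∈ D) → (x ∈ D → y ∈ D → z ∈ D) →
  (x ≢ t → y ≢ t → z ≢ t) → z ∈ and₁ x y
∈and₁ F F f _ _ _ = ∉D⇒≡F (F∉D ∘ f)
∈and₁ F t f _ _ _ = ∉D⇒≡F (F∉D ∘ f)
∈and₁ F T f _ _ _ = ∉D⇒≡F (F∉D ∘ f)
∈and₁ t F _ g _ _ = ∉D⇒≡F (F∉D ∘ g)
∈and₁ t t _ _ h _ = h t∈D t∈D
∈and₁ t T _ _ h _ = h t∈D T∈D
∈and₁ T F _ g _ _ = ∉D⇒≡F (F∉D ∘ g)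
∈and₁ T t _ _ h _ = h T∈D t∈D
∈and₁ T T _ _ h k = ∈D∧≢t⇒≡T (h T∈D T∈D) (k T≢t T≢t)

∈or₁ : ∀ x y → (z ∈ D → x ∈ D ⊎ y ∈ D) → (x ∈ D → z ∈ D) → (y ∈ D → z ∈ D) →
  (x ≢ t → y ≢ t → z ≢ t) → z ∈ or₁ x y
∈or₁ F F f _ _ _ = ∉D⇒≡F ([ F∉D , F∉D ]′ ∘ f)
∈or₁ F t _ _ h _ = h t∈D
∈or₁ F T _ _ h k = ∈D∧≢t⇒≡T (h T∈D) (k F≢t T≢t)
∈or₁ t F _ g _ _ = g t∈D
∈or₁ t t _ g _ _ = g t∈D
∈or₁ t T _ g _ _ = g t∈D
∈or₁ T F _ g _ k = ∈D∧≢t⇒≡T (g T∈D) (k T≢t F≢t)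
∈or₁ T t _ g _ _ = g T∈D
∈or₁ T T _ g _ k = ∈D∧≢t⇒≡T (g T∈D) (k T≢t T≢t)

∈imp₁ : ∀ x y → (z ∈ D → x ∈ D → y ∈ D) → (x ∉ D → z ∈ D) → (y ∈ D → z ∈ D) →
  (x ≢ t → y ≢ t → z ≢ t) → z ∈ imp₁ x y
∈imp₁ F F _ g _ k = ∈D∧≢t⇒≡T (g F∉D) (k F≢t F≢t)
∈imp₁ F t _ _ h _ = h t∈D
∈imp₁ F T _ _ h k = ∈D∧≢t⇒≡T (h T∈D) (k F≢t T≢t)
∈imp₁ t F f _ _ _ = ∉D⇒≡F λ z∈D → F∉D (f z∈D t∈D)
∈imp₁ t t _ _ h _ = h t∈D
∈imp₁ t T _ _ h _ = h T∈D
∈imp₁ T F f _ _ _ = ∉D⇒≡F λ z∈D → F∉D (f z∈D T∈D)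
∈imp₁ T t _ _ h _ = h t∈D
∈imp₁ T T _ _ h k = ∈D∧≢t⇒≡T (h T∈D) (k T≢t T≢t)

-- Closure properties of a maximal set and its valuation

module Canonical (em : ExcludedMiddle ℓ) (φ : Formula) {Δ : Pred Formula ℓ}
  (Δ-maximal : Lindenbaum.IsMaximal 1 φ Δ) where

  open Lindenbaum.IsMaximal Δ-maximal

  -- If `α` were missing, maximality and the deduction theorem would give `Δ` a proof of `α ⇒ φ`,
  -- hence of `φ`.
  ⊢⇒∈ : Δ ⊢C[ 1 ] α → α ∈ Δ
  ⊢⇒∈ d = decidable-stable em λ α∉ → unprovable (mp (deduction (maximal α∉)) d)

  ∈-mp : α ⇒ β ∈ Δ → α ∈ Δ → β ∈ Δ
  ∈-mp p q = ⊢⇒∈ (mp (hyp p) (hyp q))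

  ∈-axiom : Axiom 1 (α ⇒ β) → α ∈ Δ → β ∈ Δ
  ∈-axiom a = ∈-mp (⊢⇒∈ (ax a))

  ∈-∧ : α ∈ Δ → β ∈ Δ → α ∧ β ∈ Δ
  ∈-∧ p q = ∈-mp (∈-axiom (∧-I _ _) p) q

  -- `Δ` is prime: if both disjuncts were missing, each would imply `φ`, and so would the
  -- disjunction.
  ∈-∨ : α ∨ β ∈ Δ → α ∈ Δ ⊎ β ∈ Δ
  ∈-∨ {α} {β} p with em {α ∈ Δ} | em {β ∈ Δ}
  ... | yes α∈ | _      = inj₁ α∈
  ... | no _   | yes β∈ = inj₂ β∈
  ... | no α∉  | no β∉  = contradiction
    (mp (mp (mp (ax (∨-E α β φ)) (deduction (maximal α∉))) (deduction (maximal β∉))) (hyp p))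
    unprovable

  ∈-tnd : ∀ α → α ∈ Δ ⊎ ~ α ∈ Δ
  ∈-tnd α = ∈-∨ (⊢⇒∈ (ax (tnd α)))

  ∉⇒~∈ : α ∉ Δ → ~ α ∈ Δ
  ∉⇒~∈ α∉ = [ (λ α∈ → contradiction α∈ α∉) , id ]′ (∈-tnd _)

  ¬[α,~α]⇒¹∈ : ¬ (α ∈ Δ × ~ α ∈ Δ) → α ^ 1 ∈ Δ
  ¬[α,~α]⇒¹∈ ¬p = ∉⇒~∈ λ α∧~α∈ → ¬p (∈-axiom (∧-E₁ _ _) α∧~α∈ , ∈-axiom (∧-E₂ _ _) α∧~α∈)

  ¹∈⇒¬[α,~α] : α ^ 1 ∈ Δ → ¬ (α ∈ Δ × ~ α ∈ Δ)
  -- (bc₁) is instantiated with `φ` as the arbitrary conclusion.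
  ¹∈⇒¬[α,~α] α¹∈ (α∈ , ~α∈) = unprovable (mp (mp (mp (ax (bc _ φ)) (hyp α¹∈)) (hyp α∈)) (hyp ~α∈))

  -- From ¬α and α¹ the axiom (bc₁) gives α ⇒ β, so Peirce's law is not needed as an axiom.
  ∉⇒⇒∈ : α ∉ Δ → α ⇒ β ∈ Δ
  ∉⇒⇒∈ {α} {β} α∉ = ⊢⇒∈ (deduction
    (mp (mp (mp (ax (bc α β)) (hyp (inj₁ (¬[α,~α]⇒¹∈ (α∉ ∘ proj₁))))) (hyp (inj₂ refl)))
        (hyp (inj₁ (∉⇒~∈ α∉)))))

  value : ∀ {A B : Set ℓ} → Dec A → Dec B → Three
  value (no _)  _       = F
  value (yes _) (yes _) = t
  value (yes _) (no _)  = T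

  ν : Formula → Three
  ν α = value (em {α ∈ Δ}) (em {~ α ∈ Δ})

  ∈⇒D : α ∈ Δ → ν α ∈ D
  ∈⇒D {α} α∈ with em {α ∈ Δ} | em {~ α ∈ Δ}
  ... | no α∉ | _     = contradiction α∈ α∉
  ... | yes _ | yes _ = t∈D
  ... | yes _ | no _  = T∈D

  D⇒∈ : ν α ∈ D → α ∈ Δ
  D⇒∈ {α} ν∈D with em {α ∈ Δ}
  ... | no _   = contradiction ν∈D F∉D
  ... | yes α∈ = α∈

  ≡t⇒∈ : ν α ≡ t → α ∈ Δ × ~ α ∈ Δ
  ≡t⇒∈ {α} ν≡t with em {α ∈ Δ} | em {~ α ∈ Δ}
  ... | yes α∈ | yes ~α∈ = α∈ , ~α∈
  ≡t⇒∈ () | no _  | _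
  ≡t⇒∈ () | yes _ | no _

  ∈⇒≡t : α ∈ Δ → ~ α ∈ Δ → ν α ≡ t
  ∈⇒≡t {α} α∈ ~α∈ with em {α ∈ Δ} | em {~ α ∈ Δ}
  ... | yes _ | yes _  = refl
  ... | no α∉ | _      = contradiction α∈ α∉
  ... | yes _ | no ~α∉ = contradiction ~α∈ ~α∉

  ≢t⇒¹∈ : ν α ≢ t → α ^ 1 ∈ Δ
  ≢t⇒¹∈ ν≢t = ¬[α,~α]⇒¹∈ λ (α∈ , ~α∈) → ν≢t (∈⇒≡t α∈ ~α∈)

  ¹∈⇒≢t : α ^ 1 ∈ Δ → ν α ≢ t
  ¹∈⇒≢t α¹∈ = ¹∈⇒¬[α,~α] α¹∈ ∘ ≡t⇒∈

  P∈ : ν α ≢ t → ν β ≢ t → ((α ∧ β) ^ 1 ∧ (α ∨ β) ^ 1) ∧ (α ⇒ β) ^ 1 ∈ Δ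
  P∈ ν≢t ν′≢t = ∈-axiom (P _ _) (∈-∧ (≢t⇒¹∈ ν≢t) (≢t⇒¹∈ ν′≢t))

  ν-isValuation : IsValuation A-C₁ ν
  ν-isValuation = record
    { neg-ok = λ α → ∈neg₁ (ν α)
        (λ ν∉D → ∈⇒D (∉⇒~∈ (ν∉D ∘ ∈⇒D)))
        (λ ν~≡t → ∈⇒D (∈-axiom (dne α) (proj₂ (≡t⇒∈ ν~≡t))))
        (λ ν≡t → ∈⇒D (proj₂ (≡t⇒∈ ν≡t)))
        (λ α∈ ~α∈ → ∈⇒≡t (D⇒∈ α∈) (D⇒∈ ~α∈))
    ; and-ok = λ α β → ∈and₁ (ν α) (ν β)
        (∈⇒D ∘ ∈-axiom (∧-E₁ α β) ∘ D⇒∈)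
        (∈⇒D ∘ ∈-axiom (∧-E₂ α β) ∘ D⇒∈)
        (λ α∈ β∈ → ∈⇒D (∈-∧ (D⇒∈ α∈) (D⇒∈ β∈)))
        (λ p q → ¹∈⇒≢t (∈-axiom (∧-E₁ _ _) (∈-axiom (∧-E₁ _ _) (P∈ p q))))
    ; or-ok  = λ α β → ∈or₁ (ν α) (ν β)
        ([ inj₁ ∘ ∈⇒D , inj₂ ∘ ∈⇒D ]′ ∘ ∈-∨ ∘ D⇒∈)
        (∈⇒D ∘ ∈-axiom (∨-I₁ α β) ∘ D⇒∈)
        (∈⇒D ∘ ∈-axiom (∨-I₂ α β) ∘ D⇒∈)
        (λ p q → ¹∈⇒≢t (∈-axiom (∧-E₂ _ _) (∈-axiom (∧-E₁ _ _) (P∈ p q))))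
    ; imp-ok = λ α β → ∈imp₁ (ν α) (ν β)
        (λ α⇒β∈ α∈ → ∈⇒D (∈-mp (D⇒∈ α⇒β∈) (D⇒∈ α∈)))
        (λ ν∉D → ∈⇒D (∉⇒⇒∈ (ν∉D ∘ ∈⇒D)))
        (∈⇒D ∘ ∈-axiom (K β α) ∘ D⇒∈)
        (λ p q → ¹∈⇒≢t (∈-axiom (∧-E₂ _ _) (P∈ p q)))
    }

  ν∈𝓕 : ν ∈ F-C₁
  ν∈𝓕 = ν-isValuation , λ α ν≡t →
    let α∈ , ~α∈ = ≡t⇒∈ ν≡t
    in sym (∈D∧≢t⇒≡T (∈⇒D (∈-∧ α∈ ~α∈))
         -- The value `t` would put `~ (α ∧ ~ α)`, which is `α ^ 1` by definition, into `Δ` beside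
         -- `α` and `~ α`.
         λ ν∧≡t → ¹∈⇒¬[α,~α] (proj₂ (≡t⇒∈ ν∧≡t)) (α∈ , ~α∈))

-- Completeness and the equivalence

complete : ExcludedMiddle ℓ → (Γ : Pred Formula ℓ) (φ : Formula) → Γ ⊨[ RM-C₁ ] φ → Γ ⊢C[ 1 ] φ
complete em Γ φ Γ⊨φ = decidable-stable em λ Γ⊬φ →
  let open Lindenbaum 1 φ
      Δ-maximal = limit-maximal Γ em Γ⊬φ
      open Canonical em φ Δ-maximal
  -- `Γ` is stage 0 of the limit, so `ν` designates it; designating `φ` too would put `φ` into the
  -- limit.
  in IsMaximal.unprovable Δ-maximal (hyp (D⇒∈ (Γ⊨φ ν ν∈𝓕 λ γ∈Γ → ∈⇒D (0 , γ∈Γ))))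

mainTheorem9 : ∀ {ℓ} → ExcludedMiddle ℓ → (Γ : Pred Formula ℓ) (φ : Formula) →
    (Γ ⊢C[ 1 ] φ) ⇔ (Γ ⊨[ RM-C₁ ] φ)
mainTheorem9 em Γ φ = mk⇔ sound (complete em Γ φ)
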